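{- Let $D$ be an ASD and suppose $D\equiv D_1\times\cdots\times D_m$ and $D\equiv D'_1\times\cdots\times D'_n$, where all $D_i$ and $D'_j$ are binary ASDs. Then the factorization is unique up to order and equivalence of the factors: $m=n$ and there exists a permutation $\gamma$ of $\{1,\dots,m\}$ such that $D_i\equiv D'_{\gamma(i)}$ for all $i$.
   Context: An ASD is a pair $D=(\mathcal{S}_D,\mathcal{P}_D)$ with $\mathcal{S}_D$ a finite set and $\mathcal{P}_D$ a finite family of set partitions of $\mathcal{S}_D$. It is binary if every $\pi\in\mathcal{P}_D$ has exactly 2 blocks. For partitions, $\pi\preceq\pi'$ means every block of $\pi$ lies in a block of $\pi'$; for $\phi:\mathcal{S}\to\mathcal{S}'$ and a partition $\pi$ of $\mathcal{S}'$, $\pi\circ\phi$ is the partition of $\mathcal{S}$ where $x,y$ share a block iff $\phi(x),\phi(y)$ share a block of $\pi$. $D\le D'$ means there exist $\phi:\mathcal{S}_D\to\mathcal{S}_{D'}$, $\alpha:\mathcal{P}_D\to\mathcal{P}_{D'}$ with $\alpha(\pi)\circ\phi\preceq\pi$ for all $\pi\in\mathcal{P}_D$; $D\equiv D'$ means $D\le D'$ and $D'\le D$. The direct product $D\times D'$ has state space $\mathcal{S}_D\times\mathcal{S}_{D'}$ and partition set $\{\pi\times\pi':\pi\in\mathcal{P}_D,\pi'\in\mathcal{P}_{D'}\}$, where $\pi\times\pi'=\{B\times B': B\in\pi,B'\in\pi'\}$; products of several ASDs are formed iteratively.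
   Formalization: Every factor is assumed to have a nonempty partition family; otherwise the claim fails: the ASD D with one state and no partitions is vacuously binary and satisfies D ≡ D × D, so m = 1 and n = 2. -}

module Defs where

open import Data.Nat using (ℕ; zero; suc; _*_)
open import Data.Fin using (Fin; zero; suc; combine; remQuot; inject₁; fromℕ)
open import Data.Product using (Σ; Σ-syntax; _×_; _,_; proj₁; proj₂)
open import Data.Sum using (_⊎_)
open import Relation.Binary.PropositionalEquality using (_≡_; _≢_)
open import Function using (_∘_)

-- A set partition of the finite set Fin k, encoded by a block labelling:
-- x and y lie in the same block iff they receive the same label.
-- (A partition of a k-element set has at most k blocks, so labels in Fin k suffice.)
Partition : ℕ → Set
Partition k = Fin k → Fin k

-- Same-block relation for a partition given by any labelling (the pullback
-- π ∘ φ of a partition is again given by a labelling, with labels of the target).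
SameBlock : {k : ℕ} {L : Set} → (Fin k → L) → Fin k → Fin k → Set
SameBlock π x y = π x ≡ π y

_⪯_ : {k : ℕ} {L L' : Set} → (Fin k → L) → (Fin k → L') → Set
_⪯_ {k} π π' = (x y : Fin k) → SameBlock π x y → SameBlock π' x y

-- An ASD: state space Fin nS (a finite set), and a finite family of
-- partitions indexed by Fin nP.
record ASD : Set where
  constructor asd
  field
    nS   : ℕ
    nP   : ℕ
    part : Fin nP → Partition nS
open ASD public

TwoBlocks : {k : ℕ} → Partition k → Set
TwoBlocks {k} π = Σ[ x ∈ Fin k ] Σ[ y ∈ Fin k ]
  ((π x ≢ π y) × ((z : Fin k) → (π z ≡ π x) ⊎ (π z ≡ π y)))

Binary : ASD → Set
Binary D = (i : Fin (nP D)) → TwoBlocks (part D i)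

_≤ᴬ_ : ASD → ASD → Set
D ≤ᴬ D' = Σ[ φ ∈ (Fin (nS D) → Fin (nS D')) ]
          Σ[ α ∈ (Fin (nP D) → Fin (nP D')) ]
          ((i : Fin (nP D)) → (part D' (α i) ∘ φ) ⪯ part D i)

_≡ᴬ_ : ASD → ASD → Set
D ≡ᴬ D' = (D ≤ᴬ D') × (D' ≤ᴬ D)

_×ᵖ_ : {k k' : ℕ} → Partition k → Partition k' → Partition (k * k')
_×ᵖ_ {k} {k'} π π' s = combine (π (proj₁ (remQuot {k} k' s))) (π' (proj₂ (remQuot {k} k' s)))

_×ᴬ_ : ASD → ASD → ASD
D ×ᴬ D' = asd (nS D * nS D') (nP D * nP D')
  (λ j → part D (proj₁ (remQuot {nP D} (nP D') j)) ×ᵖ part D' (proj₂ (remQuot {nP D} (nP D') j)))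

Prod : (m : ℕ) → (Fin (suc m) → ASD) → ASD
Prod zero    Ds = Ds zero
Prod (suc m) Ds = Prod m (Ds ∘ inject₁) ×ᴬ Ds (fromℕ (suc m))

{-# OPTIONS --safe #-}
module Submission where

-- After merging equal partitions within each factor, every partition of a product of n binary factors has
-- exactly 2ⁿ blocks. Hence equivalent products have equally many factors, and a reduction (φ, α) between them
-- is exact: φ also preserves lying in a common block. So α is injective, and after iterating the round trip the
-- two question maps may be taken mutually inverse. A change of a single coordinate of α q can only come from a
-- change of at most one coordinate of q, so lines through a fixed q (one coordinate varying) go to lines through
-- α q. This matches the coordinates having more than one question. Along such a line the remaining coordinates
-- of the image state are determined by the fixed state coordinates, so projecting reduces a factor to its
-- partner. All factors with a single question are equivalent to one another.

open import Defs
open import Data.Nat using (ℕ; zero; suc; _+_; _*_; _^_; _≤_; _>_)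
open import Data.Nat.GeneralisedArithmetic using (fold; fold-+)
import Data.Nat.Properties as ℕ
open import Data.Fin using (Fin; zero; suc; toℕ; fromℕ; fromℕ<; inject₁; combine; remQuot; finToFun; funToFin; punchOut)
open import Data.Fin.Properties
  using (_≟_; any?; all?; ¬∀⟶∃¬; pigeonhole; injective⇒≤; <⇒notInjective; punchOut-injective;
         combine-injective; combine-remQuot; remQuot-combine; finToFun-funToFin; funToFin-finToFin)
open import Data.Fin.Permutation using (Permutation′; transpose; _∘ₚ_) renaming (id to idₚ)
open import Data.Fin.Relation.Unary.Top using (View; view; view-unique; ‵fromℕ; ‵inj₁)
open import Data.List using (List; []; _∷_; allFin)
open import Data.List.Membership.Propositional using (_∈_)
open import Data.List.Membership.Propositional.Properties using (∈-allFin)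
open import Data.List.Relation.Unary.Any using (here; there)
open import Data.Product using (Σ-syntax; ∃-syntax; _×_; _,_; proj₁; proj₂; swap)
open import Data.Sum using (_⊎_; inj₁; inj₂)
open import Data.Empty using (⊥; ⊥-elim)
open import Function using (_∘_; id)
open import Function.Bundles using (_↔_; Inverse; Injection)
open import Function.Properties.Inverse using (↔⇒↣)
open import Function.Definitions using (Injective)
open import Relation.Nullary using (¬_; Dec; yes; no; contradiction)
open import Relation.Nullary.Decidable using (_→-dec_; decidable-stable; ¬?)
open import Relation.Binary.PropositionalEquality
  using (_≡_; _≢_; refl; sym; ≢-sym; trans; cong; cong₂; subst; module ≡-Reasoning)

-- Injections, periods, representatives and permutations of finite sets.

injective⇒surjective : ∀ {n} {f : Fin n → Fin n} → Injective _≡_ _≡_ f → ∀ y → ∃[ x ] f x ≡ y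
injective⇒surjective {suc n} {f} f-inj y with any? (λ x → f x ≟ y)
... | yes hit = hit
... | no miss = contradiction
  (λ {a b} eq → f-inj (punchOut-injective (miss ∘ (a ,_) ∘ sym) (miss ∘ (b ,_) ∘ sym) eq))
  (<⇒notInjective {f = λ x → punchOut {i = y} {j = f x} (miss ∘ (x ,_) ∘ sym)} (ℕ.n<1+n n))

fold-injective : ∀ {A : Set} {f : A → A} → Injective _≡_ _≡_ f →
  ∀ k {x y} → fold x f k ≡ fold y f k → x ≡ y
fold-injective f-inj zero    eq = eq
fold-injective f-inj (suc k) eq = fold-injective f-inj k (f-inj eq)

funToFin-cong⁻ : ∀ {m n} (f g : Fin m → Fin n) → funToFin f ≡ funToFin g → ∀ x → f x ≡ g x
funToFin-cong⁻ f g eq x =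
  trans (sym (finToFun-funToFin f x)) (trans (cong (λ c → finToFun c x) eq) (finToFun-funToFin g x))

funToFin-cong : ∀ {m n} {f g : Fin m → Fin n} → (∀ x → f x ≡ g x) → funToFin f ≡ funToFin g
funToFin-cong {zero}  eq = refl
funToFin-cong {suc m} eq = cong₂ combine (eq zero) (funToFin-cong (eq ∘ suc))

-- Two of the first `n ^ n + 1` iterates coincide as functions, and injectivity cancels the
-- iterations they share. The form `suc d` keeps the period positive.
injective⇒periodic : ∀ {n} {f : Fin n → Fin n} → Injective _≡_ _≡_ f →
  ∃[ d ] (∀ x → fold x f (suc d) ≡ x)
injective⇒periodic {n} {f} f-inj
  with pigeonhole (ℕ.n<1+n (n ^ n)) (λ k → funToFin (λ x → fold x f (toℕ k)))
... | i , j , i<j , eq with ℕ.m≤n⇒∃[o]m+o≡n i<j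
... | d , i+d≡j = d , λ x → sym (fold-injective f-inj (toℕ i)
  (begin
    fold x f (toℕ i)                   ≡⟨ funToFin-cong⁻ (λ z → fold z f (toℕ i)) (λ z → fold z f (toℕ j)) eq x ⟩
    fold x f (toℕ j)                   ≡⟨ cong (fold x f) (trans (sym i+d≡j) (sym (ℕ.+-suc (toℕ i) d))) ⟩
    fold x f (toℕ i + suc d)           ≡⟨ fold-+ x f (toℕ i) ⟩
    fold (fold x f (suc d)) f (toℕ i)  ∎))
  where open ≡-Reasoning

-- Greedy choice from the far end: `zero` becomes a new representative only if it is unrelated to
-- all those already chosen.
representatives : ∀ {k} (R : Fin k → Fin k → Set) → (∀ a b → Dec (R a b)) →
  (∀ a → R a a) → (∀ {a b} → R a b → R b a) →
  Σ[ N ∈ ℕ ] Σ[ rep ∈ (Fin N → Fin k) ] Σ[ cls ∈ (Fin k → Fin N) ]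
    (∀ a → R (rep (cls a)) a) × (∀ {a b} → R (rep a) (rep b) → a ≡ b)
representatives {zero} R R? R-refl R-sym = 0 , (λ ()) , (λ ()) , (λ ()) , λ { {()} }
representatives {suc k} R R? R-refl R-sym
  with representatives (λ a b → R (suc a) (suc b)) (λ a b → R? (suc a) (suc b)) (R-refl ∘ suc) R-sym
... | N , rep , cls , rep-cls , rep-inj with any? (λ a → R? (suc (rep a)) zero)
... | yes (a₀ , Ra₀) = N , suc ∘ rep , cls⁺ , rep-cls⁺ , rep-inj
  where
  cls⁺ : Fin (suc k) → Fin N
  cls⁺ zero    = a₀
  cls⁺ (suc a) = cls a
  rep-cls⁺ : ∀ a → R (suc (rep (cls⁺ a))) a
  rep-cls⁺ zero    = Ra₀
  rep-cls⁺ (suc a) = rep-cls a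
... | no ¬R = suc N , rep⁺ , cls⁺ , rep-cls⁺ , (λ {a} {b} → rep-inj⁺ a b)
  where
  rep⁺ : Fin (suc N) → Fin (suc k)
  rep⁺ zero    = zero
  rep⁺ (suc a) = suc (rep a)
  cls⁺ : Fin (suc k) → Fin (suc N)
  cls⁺ zero    = zero
  cls⁺ (suc a) = suc (cls a)
  rep-cls⁺ : ∀ a → R (rep⁺ (cls⁺ a)) a
  rep-cls⁺ zero    = R-refl zero
  rep-cls⁺ (suc a) = rep-cls a
  rep-inj⁺ : ∀ a b → R (rep⁺ a) (rep⁺ b) → a ≡ b
  rep-inj⁺ zero    zero    _ = refl
  rep-inj⁺ zero    (suc b) r = contradiction (b , R-sym r) ¬R
  rep-inj⁺ (suc a) zero    r = contradiction (a , r) ¬R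
  rep-inj⁺ (suc a) (suc b) r = cong suc (rep-inj r)

transpose-left : ∀ {n} (i j : Fin n) → Inverse.to (transpose i j) i ≡ j
transpose-left i j with i ≟ i
... | yes _ = refl
... | no i≢i = contradiction refl i≢i

transpose-other : ∀ {n} {i j k : Fin n} → k ≢ i → k ≢ j → Inverse.to (transpose i j) k ≡ k
transpose-other {i = i} {j} {k} k≢i k≢j with k ≟ i
... | yes k≡i = contradiction k≡i k≢i
... | no _ with k ≟ j
...   | yes k≡j = contradiction k≡j k≢j
...   | no _ = refl

-- The prescribed values are installed one at a time, by composing with transpositions.
extend-to-permutation : ∀ {n} (R : Fin n → Fin n → Set) → (∀ i → Dec (∃[ j ] R i j)) →
  (∀ {i j j′} → R i j → R i j′ → j ≡ j′) → (∀ {i i′ j} → R i j → R i′ j → i ≡ i′) →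
  Σ[ γ ∈ Permutation′ n ] (∀ {i j} → R i j → Inverse.to γ i ≡ j)
extend-to-permutation {n} R R? functional injective =
  let γ , γ-ok = extend (allFin n) in γ , λ {i} → γ-ok (∈-allFin i)
  where
  extend : (l : List (Fin n)) →
    Σ[ γ ∈ Permutation′ n ] (∀ {i j} → i ∈ l → R i j → Inverse.to γ i ≡ j)
  extend [] = idₚ , λ ()
  extend (i ∷ l) with extend l | R? i
  ... | γ , γ-ok | no ¬Ri = γ , λ
    { (here refl) r → contradiction (_ , r) ¬Ri
    ; (there i∈l) r → γ-ok i∈l r }
  ... | γ , γ-ok | yes (j , Rij) = γ ∘ₚ transpose (Inverse.to γ i) j , λ
    { (here refl) r → trans (transpose-left (Inverse.to γ i) j) (functional Rij r)
    ; {i′} (there i′∈l) r → step i′∈l r (i′ ≟ i) }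
    where
    step : ∀ {i′ j′} → i′ ∈ l → R i′ j′ → Dec (i′ ≡ i) →
      Inverse.to (γ ∘ₚ transpose (Inverse.to γ i) j) i′ ≡ j′
    step i′∈l r (yes refl) = trans (transpose-left (Inverse.to γ i) j) (functional Rij r)
    -- The new transposition spares the value at `i′`: it differs from the value at `i` because `γ`
    -- is injective, and from `j` because `R` is.
    step i′∈l r (no i′≢i) = trans
      (transpose-other (i′≢i ∘ Injection.injective (↔⇒↣ γ))
        (λ γi′≡j → i′≢i (injective r (subst (R i) (trans (sym γi′≡j) (γ-ok i′∈l r)) Rij))))
      (γ-ok i′∈l r)

-- Reductions, and refinement of two-block partitions.

≤ᴬ-trans : ∀ D E F → D ≤ᴬ E → E ≤ᴬ F → D ≤ᴬ F
≤ᴬ-trans D E F (φ , α , h) (ψ , β , k) =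
  ψ ∘ φ , β ∘ α , λ q x y eq → h q x y (k (α q) (φ x) (φ y) eq)

≡ᴬ-trans : ∀ D E F → D ≡ᴬ E → E ≡ᴬ F → D ≡ᴬ F
≡ᴬ-trans D E F (r , r′) (s , s′) = ≤ᴬ-trans D E F r s , ≤ᴬ-trans F E D s′ r′

≤ᴬ-power : ∀ D ((φ , α , _) : D ≤ᴬ D) k q →
  (λ x → part D (fold q α k) (fold x φ k)) ⪯ part D q
≤ᴬ-power D r zero q x y eq = eq
≤ᴬ-power D r@(φ , α , h) (suc k) q x y eq =
  ≤ᴬ-power D r k q x y (h (fold q α k) (fold x φ k) (fold y φ k) eq)

⪯-dec : ∀ {k l l′} (π : Fin k → Fin l) (π′ : Fin k → Fin l′) → Dec (π ⪯ π′)
⪯-dec π π′ = all? λ x → all? λ y → (π x ≟ π y) →-dec (π′ x ≟ π′ y)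

¬⪯⇒separated : ∀ {k l l′} (π : Fin k → Fin l) (π′ : Fin k → Fin l′) → ¬ (π ⪯ π′) →
  ∃[ x ] ∃[ y ] (π x ≡ π y × π′ x ≢ π′ y)
¬⪯⇒separated π π′ π⋠π′
  with ¬∀⟶∃¬ _ _ (λ x → all? λ y → (π x ≟ π y) →-dec (π′ x ≟ π′ y)) π⋠π′
... | x , ¬x with ¬∀⟶∃¬ _ _ (λ y → (π x ≟ π y) →-dec (π′ x ≟ π′ y)) ¬x
... | y , ¬xy = x , y
  , decidable-stable (π x ≟ π y) (λ x≁y → ¬xy (⊥-elim ∘ x≁y))
  , λ x∼y → ¬xy (λ _ → x∼y)

three-in-two-blocks : ∀ {k} {π : Partition k} → TwoBlocks π → ∀ x y z →
  π x ≡ π y ⊎ π x ≡ π z ⊎ π y ≡ π z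
three-in-two-blocks (_ , _ , _ , cover) x y z with cover x | cover y | cover z
... | inj₁ p | inj₁ q | _      = inj₁ (trans p (sym q))
... | inj₂ p | inj₂ q | _      = inj₁ (trans p (sym q))
... | inj₁ p | inj₂ q | inj₁ r = inj₂ (inj₁ (trans p (sym r)))
... | inj₁ p | inj₂ q | inj₂ r = inj₂ (inj₂ (trans q (sym r)))
... | inj₂ p | inj₁ q | inj₁ r = inj₂ (inj₂ (trans q (sym r)))
... | inj₂ p | inj₁ q | inj₂ r = inj₂ (inj₁ (trans p (sym r)))

-- If `x` and `y` shared a block of `π′` but not of `π`, they would represent both blocks of `π`, so
-- every state would lie with `x` in `π′`, which has two blocks.
⪯-sym : ∀ {k} {π π′ : Partition k} → TwoBlocks π → TwoBlocks π′ → π ⪯ π′ → π′ ⪯ π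
⪯-sym {π = π} {π′} two (a , b , a≁b , _) π⪯π′ x y x∼′y =
  decidable-stable (π x ≟ π y) λ x≁y → a≁b (trans (constant x≁y a) (sym (constant x≁y b)))
  where
  constant : π x ≢ π y → ∀ z → π′ z ≡ π′ x
  constant x≁y z with three-in-two-blocks two x y z
  ... | inj₁ x∼y        = contradiction x∼y x≁y
  ... | inj₂ (inj₁ x∼z) = π⪯π′ z x (sym x∼z)
  ... | inj₂ (inj₂ y∼z) = trans (π⪯π′ z y (sym y∼z)) (sym x∼′y)

-- For binary partitions `⪯` is symmetric, so this excludes repeated partitions, however they are
-- labelled.
Reduced : ASD → Set
Reduced D = ∀ a b → part D a ⪯ part D b → a ≡ b

-- One index is kept for each class of equal partitions; the states stay, so the identity is the
-- state map both ways.
reduce : ∀ D → Binary D → Fin (nP D) →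
  Σ[ D′ ∈ ASD ] (D ≡ᴬ D′) × Binary D′ × Reduced D′ × Fin (nP D′)
reduce D bin q with representatives (λ a b → part D a ⪯ part D b) (λ a b → ⪯-dec (part D a) (part D b))
                      (λ _ _ _ eq → eq) (λ {a} {b} → ⪯-sym (bin a) (bin b))
... | N , rep , cls , rep-cls , rep-inj =
  asd (nS D) N (part D ∘ rep) ,
  ((id , cls , rep-cls) , (id , rep , λ _ _ _ eq → eq)) , bin ∘ rep , (λ _ _ → rep-inj) , cls q

-- Coordinates on iterated products.

record Tuples {n : ℕ} (K : Fin n → ℕ) (N : ℕ) : Set where
  field
    proj           : Fin N → ∀ i → Fin (K i)
    tuple          : (∀ i → Fin (K i)) → Fin N
    proj-tuple     : ∀ f i → proj (tuple f) i ≡ f i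
    proj-injective : ∀ {x y} → (∀ i → proj x i ≡ proj y i) → x ≡ y

  private
    update : (∀ i → Fin (K i)) → ∀ i → Fin (K i) → ∀ j → Fin (K j)
    update f i a j with i ≟ j
    ... | yes refl = a
    ... | no _     = f j

    update-same : ∀ f i a → update f i a i ≡ a
    update-same f i a with i ≟ i
    ... | yes refl = refl
    ... | no i≢i   = contradiction refl i≢i

    update-other : ∀ f i a {j} → j ≢ i → update f i a j ≡ f j
    update-other f i a {j} j≢i with i ≟ j
    ... | yes refl = contradiction refl j≢i
    ... | no _     = refl

  -- That is, `x` and `y` lie on a common line in direction `i`.
  AgreeOff : Fin n → Fin N → Fin N → Set
  AgreeOff i x y = ∀ j → j ≢ i → proj x j ≡ proj y j

  infixl 8 _[_≔_]
  abstract
    _[_≔_] : Fin N → ∀ i → Fin (K i) → Fin N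
    x [ i ≔ a ] = tuple (update (proj x) i a)

    proj-same : ∀ x i a → proj (x [ i ≔ a ]) i ≡ a
    proj-same x i a = trans (proj-tuple _ i) (update-same (proj x) i a)

    agree-off : ∀ x i a → AgreeOff i (x [ i ≔ a ]) x
    agree-off x i a j j≢i = trans (proj-tuple _ j) (update-other (proj x) i a j≢i)

  agree-off⁻ : ∀ {x y i} → AgreeOff i x y → x ≡ y [ i ≔ proj x i ]
  agree-off⁻ {x} {y} {i} x≈y = proj-injective λ j → case j (j ≟ i)
    where
    case : ∀ j → Dec (j ≡ i) → proj x j ≡ proj (y [ i ≔ proj x i ]) j
    case j (yes refl) = sym (proj-same y i (proj x i))
    case j (no j≢i)   = trans (x≈y j j≢i) (sym (agree-off y i (proj x i) j j≢i))

tuples-one : (K : Fin 1 → ℕ) → Tuples K (K zero)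
tuples-one K = record
  { proj = λ { x zero → x }
  ; tuple = λ f → f zero
  ; proj-tuple = λ { f zero → refl }
  ; proj-injective = λ eq → eq zero
  }

tuples-power : ∀ n k → Tuples {n} (λ _ → k) (k ^ n)
tuples-power n k = record
  { proj = finToFun
  ; tuple = funToFin
  ; proj-tuple = finToFun-funToFin
  ; proj-injective = λ {x} {y} eq →
      trans (sym (funToFin-finToFin {n} x)) (trans (funToFin-cong eq) (funToFin-finToFin {n} y))
  }

module _ {m : ℕ} {K : Fin (suc (suc m)) → ℕ} {N : ℕ} (T : Tuples (K ∘ inject₁) N) where
  open Tuples T

  private
    last : ℕ
    last = K (fromℕ (suc m))

  -- `Prod` appends its last factor on the right, so an index is either the top one or an `inject₁`.
  -- The view is an argument so that uniqueness of views can replace `view i` by a known case.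
  snocProj : Fin (N * last) → ∀ {i} → View i → Fin (K i)
  snocProj x ‵fromℕ           = proj₂ (remQuot {N} last x)
  snocProj x (‵inj₁ {i = i} _) = proj (proj₁ (remQuot {N} last x)) i

  tuples-snoc : Tuples K (N * last)
  tuples-snoc = record
    { proj = λ x i → snocProj x (view i)
    ; tuple = snoc
    ; proj-tuple = λ f i → proj-snoc f (view i)
    ; proj-injective = λ {x} {y} eq → trans (sym (combine-remQuot {N} last x)) (trans
        (cong₂ combine
          (proj-injective λ i → snocProj-cong x y eq (inject₁ i) (‵inj₁ (view i)))
          (snocProj-cong x y eq _ ‵fromℕ))
        (combine-remQuot {N} last y))
    }
    where
    snoc : (∀ i → Fin (K i)) → Fin (N * last)
    snoc f = combine (tuple (f ∘ inject₁)) (f (fromℕ (suc m)))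
    proj-snoc : ∀ f {i} (v : View i) → snocProj (snoc f) v ≡ f i
    proj-snoc f ‵fromℕ = cong proj₂ (remQuot-combine (tuple (f ∘ inject₁)) (f (fromℕ (suc m))))
    proj-snoc f (‵inj₁ {i = i} _) = trans
      (cong (λ p → proj (proj₁ p) i) (remQuot-combine (tuple (f ∘ inject₁)) (f (fromℕ (suc m)))))
      (proj-tuple _ i)
    snocProj-cong : ∀ x y → (∀ i → snocProj x (view i) ≡ snocProj y (view i)) →
      ∀ i (v : View i) → snocProj x v ≡ snocProj y v
    snocProj-cong x y eq i v = subst (λ v → snocProj x v ≡ snocProj y v) (view-unique v) (eq i)

-- A block of a product partition is a product of blocks. Later arguments rely on this interface
-- rather than on the nested encoding of pairs.
record Coordinates {n : ℕ} (Ds : Fin n → ASD) (A : ASD) : Set where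
  field
    states    : Tuples (nS ∘ Ds) (nS A)
    questions : Tuples (nP ∘ Ds) (nP A)
  module S = Tuples states
  module Q = Tuples questions
  SameAt : Fin (nP A) → Fin (nS A) → Fin (nS A) → Fin n → Set
  SameAt q x y i = part (Ds i) (Q.proj q i) (S.proj x i) ≡ part (Ds i) (Q.proj q i) (S.proj y i)
  field
    same⇒ : ∀ q x y → part A q x ≡ part A q y → ∀ i → SameAt q x y i
    same⇐ : ∀ q x y → (∀ i → SameAt q x y i) → part A q x ≡ part A q y

coordinates : ∀ m (Ds : Fin (suc m) → ASD) → Coordinates Ds (Prod m Ds)
coordinates zero Ds = record
  { states = tuples-one (nS ∘ Ds)
  ; questions = tuples-one (nP ∘ Ds)
  ; same⇒ = λ { q x y eq zero → eq }
  ; same⇐ = λ q x y eq → eq zero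
  }
coordinates (suc m) Ds = record
  { states = tuples-snoc states
  ; questions = tuples-snoc questions
  ; same⇒ = λ q x y eq i → to q x y (combine-injective _ _ _ _ eq) (view i)
  ; same⇐ = λ q x y eq → cong₂ combine
      (same⇐ _ _ _ λ i → from q x y (inject₁ i) (‵inj₁ (view i)) (eq (inject₁ i)))
      (from q x y _ ‵fromℕ (eq _))
  }
  where
  B C : ASD
  B = Prod m (Ds ∘ inject₁)
  C = Ds (fromℕ (suc m))
  open Coordinates (coordinates m (Ds ∘ inject₁))
  Same : Fin (nP B * nP C) → Fin (nS B * nS C) → Fin (nS B * nS C) → ∀ i → View i → Set
  Same q x y i v = part (Ds i) (snocProj questions q v) (snocProj states x v)
                 ≡ part (Ds i) (snocProj questions q v) (snocProj states y v)
  quotS = λ x → proj₁ (remQuot {nS B} (nS C) x)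
  remS  = λ x → proj₂ (remQuot {nS B} (nS C) x)
  quotQ = λ q → proj₁ (remQuot {nP B} (nP C) q)
  remQ  = λ q → proj₂ (remQuot {nP B} (nP C) q)
  to : ∀ q x y → part B (quotQ q) (quotS x) ≡ part B (quotQ q) (quotS y)
               × part C (remQ q) (remS x) ≡ part C (remQ q) (remS y) →
       ∀ {i} (v : View i) → Same q x y i v
  to q x y (_ , eq) ‵fromℕ = eq
  to q x y (eq , _) (‵inj₁ {i = i} _) = same⇒ (quotQ q) (quotS x) (quotS y) eq i
  from : ∀ q x y i (v : View i) → Same q x y i (view i) → Same q x y i v
  from q x y i v = subst (Same q x y i) (view-unique v)

coordinatewise-≤ : ∀ {n} {Ds Es : Fin n → ASD} {A B} → Coordinates Ds A → Coordinates Es B →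
  (∀ i → Ds i ≤ᴬ Es i) → A ≤ᴬ B
coordinatewise-≤ {n} {Ds} {Es} {A} {B} X Y r = φ , α , λ q x y eq → X.same⇐ q x y λ i →
  proj₂ (proj₂ (r i)) _ _ _ (begin
    part (Es i) (αᵢ i (X.Q.proj q i)) (φᵢ i (X.S.proj x i))  ≡⟨ coordinate q x i ⟨
    part (Es i) (Y.Q.proj (α q) i) (Y.S.proj (φ x) i)         ≡⟨ Y.same⇒ (α q) (φ x) (φ y) eq i ⟩
    part (Es i) (Y.Q.proj (α q) i) (Y.S.proj (φ y) i)         ≡⟨ coordinate q y i ⟩
    part (Es i) (αᵢ i (X.Q.proj q i)) (φᵢ i (X.S.proj y i))  ∎)
  where
  open ≡-Reasoning
  module X = Coordinates X
  module Y = Coordinates Y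
  φᵢ = λ i → proj₁ (r i)
  αᵢ = λ i → proj₁ (proj₂ (r i))
  φ : Fin (nS A) → Fin (nS B)
  φ x = Y.S.tuple (λ i → φᵢ i (X.S.proj x i))
  α : Fin (nP A) → Fin (nP B)
  α q = Y.Q.tuple (λ i → αᵢ i (X.Q.proj q i))
  coordinate : ∀ q x i → part (Es i) (Y.Q.proj (α q) i) (Y.S.proj (φ x) i)
                       ≡ part (Es i) (αᵢ i (X.Q.proj q i)) (φᵢ i (X.S.proj x i))
  coordinate q x i = cong₂ (part (Es i)) (Y.Q.proj-tuple _ i) (Y.S.proj-tuple _ i)

-- Counting blocks.

-- `label` bounds the number of blocks by `N` from above, `rep` from below.
record Classes {k : ℕ} (π : Partition k) (N : ℕ) : Set where
  field
    rep           : Fin N → Fin k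
    label         : Fin k → Fin N
    label-sound   : ∀ {x y} → label x ≡ label y → π x ≡ π y
    rep-injective : ∀ {a b} → π (rep a) ≡ π (rep b) → a ≡ b

two-classes : ∀ {k} {π : Partition k} → TwoBlocks π → Classes π 2
two-classes {k} {π} (x , y , x≁y , cover) = record
  { rep = rep
  ; label = λ z → side (cover z)
  ; label-sound = λ {z} {w} → side-sound (cover z) (cover w)
  ; rep-injective = λ {a} {b} → rep-injective a b
  }
  where
  rep : Fin 2 → Fin k
  rep zero       = x
  rep (suc zero) = y
  side : ∀ {z} → π z ≡ π x ⊎ π z ≡ π y → Fin 2
  side (inj₁ _) = zero
  side (inj₂ _) = suc zero
  side-sound : ∀ {z w} (s : π z ≡ π x ⊎ π z ≡ π y) (t : π w ≡ π x ⊎ π w ≡ π y) →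
    side s ≡ side t → π z ≡ π w
  side-sound (inj₁ p) (inj₁ q) _ = trans p (sym q)
  side-sound (inj₂ p) (inj₂ q) _ = trans p (sym q)
  rep-injective : ∀ a b → π (rep a) ≡ π (rep b) → a ≡ b
  rep-injective zero       zero       _  = refl
  rep-injective zero       (suc zero) eq = contradiction eq x≁y
  rep-injective (suc zero) zero       eq = contradiction (sym eq) x≁y
  rep-injective (suc zero) (suc zero) _  = refl

-- A block of the product amounts to a choice of one of two blocks in each coordinate.
product-classes : ∀ {n} {Ds : Fin n → ASD} {A} → Coordinates Ds A → (∀ i → Binary (Ds i)) →
  ∀ q → Classes (part A q) (2 ^ n)
product-classes {n} {Ds} {A} X bin q = record
  { rep = rep
  ; label = λ x → T.tuple (label x)
  ; label-sound = λ {x} {y} eq → same⇐ q x y λ i → K.label-sound i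
      (trans (sym (T.proj-tuple (label x) i)) (trans (cong (λ c → T.proj c i) eq) (T.proj-tuple (label y) i)))
  ; rep-injective = λ {a} {b} eq → T.proj-injective λ i → K.rep-injective i
      (trans (sym (coordinate a i)) (trans (same⇒ q (rep a) (rep b) eq i) (coordinate b i)))
  }
  where
  open Coordinates X
  module T = Tuples (tuples-power n 2)
  module K i = Classes (two-classes (bin i (Q.proj q i)))
  rep : Fin (2 ^ n) → Fin (nS A)
  rep a = S.tuple (λ i → K.rep i (T.proj a i))
  label : Fin (nS A) → ∀ i → Fin 2
  label x i = K.label i (S.proj x i)
  coordinate : ∀ a i → part (Ds i) (Q.proj q i) (S.proj (rep a) i)
                     ≡ part (Ds i) (Q.proj q i) (K.rep i (T.proj a i))
  coordinate a i = cong (part (Ds i) (Q.proj q i)) (S.proj-tuple _ i)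

-- States in distinct blocks of `q` have images in distinct blocks of `α q`, so representatives
-- inject into labels.
classes-≤ : ∀ {A B M N} → A ≤ᴬ B → Fin (nP A) →
  (∀ q → Classes (part A q) M) → (∀ q → Classes (part B q) N) → M ≤ N
classes-≤ (φ , α , h) q KA KB = injective⇒≤ {f = λ a → label (KB (α q)) (φ (rep (KA q) a))}
  λ eq → rep-injective (KA q) (h q _ _ (label-sound (KB (α q)) eq))
  where open Classes

-- Otherwise the images of the blocks would leave one of the N blocks of α q unused.
equal-classes⇒exact : ∀ {A B N} ((φ , α , _) : A ≤ᴬ B) →
  (∀ q → Classes (part A q) N) → (∀ q → Classes (part B q) N) →
  ∀ q x y → part A q x ≡ part A q y → part B (α q) (φ x) ≡ part B (α q) (φ y)
equal-classes⇒exact {A} {B} {N} (φ , α , h) KA KB q x y x∼y =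
  let a , a↦x = onto (KB.label (φ x))
      b , b↦y = onto (KB.label (φ y))
      a≡b = KA.rep-injective (trans (h q _ _ (KB.label-sound a↦x))
              (trans x∼y (sym (h q _ _ (KB.label-sound b↦y)))))
  in KB.label-sound (trans (sym a↦x) (trans (cong image a≡b) b↦y))
  where
  module KA = Classes (KA q)
  module KB = Classes (KB (α q))
  image : Fin N → Fin N
  image a = KB.label (φ (KA.rep a))
  onto : ∀ c → ∃[ a ] image a ≡ c
  onto = injective⇒surjective (λ eq → KA.rep-injective (h q _ _ (KB.label-sound eq)))

-- Products of reduced binary factors.

record Factorization {n : ℕ} (Ds : Fin n → ASD) (A : ASD) : Set where
  field
    coords  : Coordinates Ds A
    binary  : ∀ i → Binary (Ds i)
    reduced : ∀ i → Reduced (Ds i)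
  open Coordinates coords public

  classes : ∀ q → Classes (part A q) (2 ^ n)
  classes = product-classes coords binary

  -- Filler for the coordinates not under study: a two-block partition supplies a state of each
  -- factor.
  base : Fin (nP A) → Fin (nS A)
  base q = S.tuple (λ i → proj₁ (binary i (Q.proj q i)))

  separate : ∀ i {a b} → a ≢ b →
    ∃[ s ] ∃[ t ] (part (Ds i) a s ≡ part (Ds i) a t × part (Ds i) b s ≢ part (Ds i) b t)
  separate i a≢b = ¬⪯⇒separated _ _ (a≢b ∘ reduced i _ _)

  same-at-cong : ∀ {q q′ x y i} → Q.proj q i ≡ Q.proj q′ i → SameAt q x y i → SameAt q′ x y i
  same-at-cong {x = x} {y} {i} eq =
    subst (λ a → part (Ds i) a (S.proj x i) ≡ part (Ds i) a (S.proj y i)) eq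

  same-other : ∀ q x i s t {j} → j ≢ i → SameAt q (x S.[ i ≔ s ]) (x S.[ i ≔ t ]) j
  same-other q x i s t {j} j≢i =
    cong (part (Ds j) (Q.proj q j)) (trans (S.agree-off x i s j j≢i) (sym (S.agree-off x i t j j≢i)))

  same-update : ∀ q x i {s t} → part (Ds i) (Q.proj q i) s ≡ part (Ds i) (Q.proj q i) t →
    part A q (x S.[ i ≔ s ]) ≡ part A q (x S.[ i ≔ t ])
  same-update q x i {s} {t} eq = same⇐ q _ _ λ j → case j (j ≟ i)
    where
    case : ∀ j → Dec (j ≡ i) → SameAt q (x S.[ i ≔ s ]) (x S.[ i ≔ t ]) j
    case j (yes refl) = trans (cong (part (Ds i) (Q.proj q i)) (S.proj-same x i s))
                          (trans eq (sym (cong (part (Ds i) (Q.proj q i)) (S.proj-same x i t))))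
    case j (no j≢i)   = same-other q x i s t j≢i

  same-update⁻ : ∀ q x i {s t} → SameAt q (x S.[ i ≔ s ]) (x S.[ i ≔ t ]) i →
    part (Ds i) (Q.proj q i) s ≡ part (Ds i) (Q.proj q i) t
  same-update⁻ q x i {s} {t} eq =
    trans (sym (cong (part (Ds i) (Q.proj q i)) (S.proj-same x i s)))
      (trans eq (cong (part (Ds i) (Q.proj q i)) (S.proj-same x i t)))

  -- Testing `q⪯q′` on states that differ only in coordinate `i` gives refinement of the `i`-th
  -- partitions.
  product-reduced : Reduced A
  product-reduced q q′ q⪯q′ = Q.proj-injective λ i → reduced i _ _ λ s t eq →
    same-update⁻ q′ (base q) i (same⇒ q′ _ _ (q⪯q′ _ _ (same-update q (base q) i eq)) i)

  -- Equivalently, the line through `q` in direction `i` has a second point.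
  Movable : Fin (nP A) → Fin n → Set
  Movable q i = ∃[ a ] a ≢ Q.proj q i

  movable? : ∀ q i → Dec (Movable q i)
  movable? q i = any? (λ a → ¬? (a ≟ Q.proj q i))

-- Reductions between products with equally many factors.

module Morphism {n : ℕ} {Ds Es : Fin n → ASD} {A B : ASD}
  (X : Factorization Ds A) (Y : Factorization Es B)
  (φ : Fin (nS A) → Fin (nS B)) (α : Fin (nP A) → Fin (nP B))
  (refines : ∀ q → (part B (α q) ∘ φ) ⪯ part A q)
  where
  private
    module X = Factorization X
    module Y = Factorization Y

  exact : ∀ q x y → part A q x ≡ part A q y → part B (α q) (φ x) ≡ part B (α q) (φ y)
  exact = equal-classes⇒exact {A} {B} (φ , α , refines) X.classes Y.classes

  -- With a common image, exactness at `q` followed by refinement at `q′` gives `q ⪯ q′` as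
  -- partitions.
  α-injective : Injective _≡_ _≡_ α
  α-injective {q} {q′} eq = X.product-reduced q q′ λ x y x∼y →
    refines q′ x y (subst (λ p → part B p (φ x) ≡ part B p (φ y)) eq (exact q x y x∼y))

  -- If q and q′ differed at both i and j, some block of q would contain three states in distinct blocks of q′;
  -- their images share a block of α q and could be told apart only by the binary k-th coordinate of α q′.
  not-two-changes : ∀ {q q′ k} → Y.Q.AgreeOff k (α q) (α q′) → ∀ {i j} → i ≢ j →
    X.Q.proj q i ≢ X.Q.proj q′ i → X.Q.proj q j ≢ X.Q.proj q′ j → ⊥
  not-two-changes {q} {q′} {k} αq≈αq′ {i} {j} i≢j qi≢ qj≢
    with X.separate i qi≢ | X.separate j qj≢
  ... | s , s′ , s∼s′ , s≁s′ | t , t′ , t∼t′ , t≁t′ =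
    exclude (three-in-two-blocks (Y.binary k (Y.Q.proj (α q′) k)) (coordinate x₁) (coordinate x₂) (coordinate x₃))
    where
    open X.S
    -- All three states share a block of `q`; `q′` separates `x₁` from both others at `i`, and `x₂`
    -- from `x₃` at `j`.
    z x₁ x₂ x₃ : Fin (nS A)
    z  = X.base q [ j ≔ t ]
    x₁ = z [ i ≔ s ]
    x₂ = z [ i ≔ s′ ]
    x₃ = x₂ [ j ≔ t′ ]
    coordinate : Fin (nS A) → Fin (nS (Es k))
    coordinate x = Y.S.proj (φ x) k
    t-at-x₂ : proj x₂ j ≡ t
    t-at-x₂ = trans (agree-off z i s′ j (≢-sym i≢j)) (proj-same (X.base q) j t)
    -- Seen as an update of itself, `x₂` can be compared with `x₃` by `same-update`.
    x₂-is : x₂ ≡ x₂ [ j ≔ t ]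
    x₂-is = subst (λ u → x₂ ≡ x₂ [ j ≔ u ]) t-at-x₂ (agree-off⁻ {i = j} (λ _ _ → refl))
    x₁∼x₂ : part A q x₁ ≡ part A q x₂
    x₁∼x₂ = X.same-update q z i s∼s′
    x₂∼x₃ : part A q x₂ ≡ part A q x₃
    x₂∼x₃ = trans (cong (part A q) x₂-is) (X.same-update q x₂ j t∼t′)
    i-separates : ¬ X.SameAt q′ x₁ x₂ i
    i-separates = s≁s′ ∘ X.same-update⁻ q′ z i
    -- Off `k`, `α q` and `α q′` ask the same questions, and exactness settles those; only
    -- coordinate `k` remains to be checked.
    lift : ∀ {x y} → part A q x ≡ part A q y →
      part (Es k) (Y.Q.proj (α q′) k) (coordinate x) ≡ part (Es k) (Y.Q.proj (α q′) k) (coordinate y) →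
      ∀ l → X.SameAt q′ x y l
    lift {x} {y} x∼y eq = X.same⇒ q′ x y (refines q′ x y (Y.same⇐ (α q′) (φ x) (φ y) λ l → case l (l ≟ k)))
      where
      case : ∀ l → Dec (l ≡ k) → Y.SameAt (α q′) (φ x) (φ y) l
      case l (yes refl) = eq
      case l (no l≢k)   = Y.same-at-cong {x = φ x} {φ y} (αq≈αq′ l l≢k)
                            (Y.same⇒ (α q) (φ x) (φ y) (exact q x y x∼y) l)
    exclude : _ → ⊥
    exclude (inj₁ eq) = i-separates (lift x₁∼x₂ eq i)
    exclude (inj₂ (inj₁ eq)) = i-separates (trans (lift (trans x₁∼x₂ x₂∼x₃) eq i)
      (cong (part (Ds i) (X.Q.proj q′ i)) (agree-off x₂ j t′ i i≢j)))
    exclude (inj₂ (inj₂ eq)) = t≁t′ (X.same-update⁻ q′ x₂ j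
      (subst (λ x → X.SameAt q′ x x₃ j) x₂-is (lift x₂∼x₃ eq j)))

  MapsLine : Fin (nP A) → Fin n → Fin n → Set
  MapsLine q i j = ∀ a → Y.Q.AgreeOff j (α (q X.Q.[ i ≔ a ])) (α q)

  -- Lines through `α q` in different directions meet only there, and injectivity keeps the image of
  -- a second point away from `α q`.
  line-unique : ∀ {q i j j′} → X.Movable q i → MapsLine q i j → MapsLine q i j′ → j ≡ j′
  line-unique {q} {i} {j} {j′} (a , a≢) line line′ = decidable-stable (j ≟ j′) λ j≢j′ →
    a≢ (trans (sym (X.Q.proj-same q i a))
      (cong (λ p → X.Q.proj p i) (α-injective (Y.Q.proj-injective λ k → agree j≢j′ k (k ≟ j)))))
    where
    agree : j ≢ j′ → ∀ k → Dec (k ≡ j) → Y.Q.proj (α (q X.Q.[ i ≔ a ])) k ≡ Y.Q.proj (α q) k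
    agree j≢j′ k (yes refl) = line′ a k j≢j′
    agree j≢j′ k (no k≢j)   = line a k k≢j

  module _ {q : Fin (nP A)} {i j : Fin n} (movable : X.Movable q i) (line : MapsLine q i j) where
    private
      state : Fin (nS (Ds i)) → Fin (nS A)
      state s = X.base q X.S.[ i ≔ s ]

      Constant : Fin (nS (Ds i)) → Fin (nS (Ds i)) → Set
      Constant s t = ∀ k → k ≢ j → Y.SameAt (α q) (φ (state s)) (φ (state t)) k

      -- Exactness applies to `q` with `a` at `i`, and off `j` the image of that question agrees
      -- with `α q`.
      block-constant : ∀ a {s t} → part (Ds i) a s ≡ part (Ds i) a t → Constant s t
      block-constant a {s} {t} eq k k≢j =
        Y.same-at-cong {x = φ (state s)} {φ (state t)} (line a k k≢j)
          (Y.same⇒ qₐ (φ (state s)) (φ (state t))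
            (exact _ _ _ (X.same-update _ (X.base q) i
              (subst (λ b → part (Ds i) b s ≡ part (Ds i) b t) (sym (X.Q.proj-same q i a)) eq))) k)
        where qₐ = α (q X.Q.[ i ≔ a ])

      -- The blocks of two different binary partitions connect all states.
      constant : ∀ s t → Constant s t
      constant s t k k≢j with X.separate i (proj₂ movable)
      ... | u , v , u∼v , u≁v = trans (to-u s k k≢j) (sym (to-u t k k≢j))
        where
        to-u : ∀ w → Constant w u
        to-u w k k≢j with three-in-two-blocks (X.binary i (X.Q.proj q i)) w u v
        ... | inj₁ w∼u        = block-constant _ w∼u k k≢j
        ... | inj₂ (inj₁ w∼v) = trans (block-constant _ w∼v k k≢j) (sym (block-constant _ u∼v k k≢j))
        ... | inj₂ (inj₂ u∼v) = contradiction u∼v u≁v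

    -- As `s` varies, the image of `state s` stays in one block off `j`, so coordinate `j` alone
    -- carries the answer to every question on the line.
    line⇒factor-≤ : Ds i ≤ᴬ Es j
    line⇒factor-≤ = (λ s → Y.S.proj (φ (state s)) j) , (λ a → Y.Q.proj (α (q X.Q.[ i ≔ a ])) j) , ok
      where
      ok : ∀ a s t → _ → part (Ds i) a s ≡ part (Ds i) a t
      ok a s t eq = subst (λ b → part (Ds i) b s ≡ part (Ds i) b t) (X.Q.proj-same q i a)
        (X.same-update⁻ qₐ (X.base q) i (X.same⇒ qₐ (state s) (state t)
          (refines qₐ _ _ (Y.same⇐ (α qₐ) _ _ λ k → case k (k ≟ j))) i))
        where
        qₐ = q X.Q.[ i ≔ a ]
        case : ∀ k → Dec (k ≡ j) → Y.SameAt (α qₐ) (φ (state s)) (φ (state t)) k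
        case k (yes refl) = eq
        case k (no k≢j)   = Y.same-at-cong {x = φ (state s)} {φ (state t)} (sym (line a k k≢j))
                              (constant s t k k≢j)

-- Mutually inverse question maps and the lines they link.

module InversePair {n : ℕ} {Ds Es : Fin n → ASD} {A B : ASD}
  (X : Factorization Ds A) (Y : Factorization Es B)
  (φ : Fin (nS A) → Fin (nS B)) (α : Fin (nP A) → Fin (nP B))
  (refines : ∀ q → (part B (α q) ∘ φ) ⪯ part A q)
  (ψ : Fin (nS B) → Fin (nS A)) (β : Fin (nP B) → Fin (nP A))
  (refines′ : ∀ p → (part A (β p) ∘ ψ) ⪯ part B p)
  (βα : ∀ q → β (α q) ≡ q)
  where
  private
    module X = Factorization X
    module Y = Factorization Y
  module F = Morphism X Y φ α refines
  module G = Morphism Y X ψ β refines′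

  -- `β` is injective, so it cancels from `βα` taken at `β p`.
  αβ : ∀ p → α (β p) ≡ p
  αβ p = G.α-injective (βα (β p))

  -- `β` takes `α q` and `α q′` back to questions on one line, so `not-two-changes` for `β` forbids
  -- a second changed coordinate.
  one-change : ∀ q q′ {i} → X.Q.AgreeOff i q q′ → ∀ {j} →
    Y.Q.proj (α q) j ≢ Y.Q.proj (α q′) j → Y.Q.AgreeOff j (α q) (α q′)
  one-change q q′ q≈q′ j≢ k k≢j = decidable-stable (_ ≟ _) λ k≢ →
    G.not-two-changes (λ l l≢i → trans (cong (λ p → X.Q.proj p l) (βα q))
      (trans (q≈q′ l l≢i) (sym (cong (λ p → X.Q.proj p l) (βα q′))))) k≢j k≢ j≢

  -- If `b` moved another coordinate `k`, it would not move `j`. The images for `a` and `b` would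
  -- then differ at `j`, hence agree at `k`, where `a` moves nothing.
  line-through : ∀ {q i a j} → Y.Q.proj (α (q X.Q.[ i ≔ a ])) j ≢ Y.Q.proj (α q) j → F.MapsLine q i j
  line-through {q} {i} {a} {j} moved b k k≢j = decidable-stable (_ ≟ _) λ k-moved →
    k-moved (trans (sym (a≈b k-moved k k≢j)) (a≈q k k≢j))
    where
    qₐ qᵇ : Fin (nP A)
    qₐ = q X.Q.[ i ≔ a ]
    qᵇ = q X.Q.[ i ≔ b ]
    qₐ≈qᵇ : X.Q.AgreeOff i qₐ qᵇ
    qₐ≈qᵇ l l≢i = trans (X.Q.agree-off q i a l l≢i) (sym (X.Q.agree-off q i b l l≢i))
    a≈q : Y.Q.AgreeOff j (α qₐ) (α q)
    a≈q = one-change qₐ q (X.Q.agree-off q i a) moved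
    a≈b : Y.Q.proj (α qᵇ) k ≢ Y.Q.proj (α q) k → Y.Q.AgreeOff j (α qₐ) (α qᵇ)
    a≈b k-moved = one-change qₐ qᵇ qₐ≈qᵇ
      (λ eq → moved (trans eq (one-change qᵇ q (X.Q.agree-off q i b) k-moved j (≢-sym k≢j))))

  moved-coordinate : ∀ {q i a} → a ≢ X.Q.proj q i →
    ∃[ j ] Y.Q.proj (α (q X.Q.[ i ≔ a ])) j ≢ Y.Q.proj (α q) j
  moved-coordinate {q} {i} {a} a≢ = ¬∀⟶∃¬ n _ (λ j → _ ≟ _) λ eq →
    a≢ (trans (sym (X.Q.proj-same q i a))
      (cong (λ p → X.Q.proj p i) (F.α-injective (Y.Q.proj-injective eq))))

  -- The halves mirror each other, so `line-unique` on the two sides makes the relation functional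
  -- and injective.
  Linked : Fin (nP A) → Fin n → Fin n → Set
  Linked q i j = (X.Movable q i × F.MapsLine q i j) × (Y.Movable (α q) j × G.MapsLine (α q) j i)

module Links {n : ℕ} {Ds Es : Fin n → ASD} {A B : ASD}
  (X : Factorization Ds A) (Y : Factorization Es B)
  (φ : Fin (nS A) → Fin (nS B)) (α : Fin (nP A) → Fin (nP B))
  (refines : ∀ q → (part B (α q) ∘ φ) ⪯ part A q)
  (ψ : Fin (nS B) → Fin (nS A)) (β : Fin (nP B) → Fin (nP A))
  (refines′ : ∀ p → (part A (β p) ∘ ψ) ⪯ part B p)
  (βα : ∀ q → β (α q) ≡ q) (q : Fin (nP A))
  where
  private
    module X = Factorization X
    module Y = Factorization Y
    module I = InversePair X Y φ α refines ψ β refines′ βα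
    module J = InversePair Y X ψ β refines′ φ α refines I.αβ
    p : Fin (nP B)
    p = α q

  module _ {i : Fin n} {a : Fin (nP (Ds i))} (a≢ : a ≢ X.Q.proj q i) where
    private
      qₐ : Fin (nP A)
      qₐ = q X.Q.[ i ≔ a ]

      j : Fin n
      j = proj₁ (I.moved-coordinate a≢)

      moved : Y.Q.proj (α qₐ) j ≢ Y.Q.proj p j
      moved = proj₂ (I.moved-coordinate a≢)

      line : I.F.MapsLine q i j
      line = I.line-through moved

      β-image : β (p Y.Q.[ j ≔ Y.Q.proj (α qₐ) j ]) ≡ qₐ
      β-image = trans (cong β (sym (Y.Q.agree-off⁻ (line a)))) (βα qₐ)

      moved-back : X.Q.proj (β (p Y.Q.[ j ≔ Y.Q.proj (α qₐ) j ])) i ≢ X.Q.proj (β p) i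
      moved-back eq = a≢ (begin
        a                                                   ≡⟨ X.Q.proj-same q i a ⟨
        X.Q.proj qₐ i                                       ≡⟨ cong (λ z → X.Q.proj z i) β-image ⟨
        X.Q.proj (β (p Y.Q.[ j ≔ Y.Q.proj (α qₐ) j ])) i   ≡⟨ eq ⟩
        X.Q.proj (β p) i                                    ≡⟨ cong (λ z → X.Q.proj z i) (βα q) ⟩
        X.Q.proj q i                                        ∎)
        where open ≡-Reasoning

    -- One point `qₐ` serves both ways: its image moves `j` off `p`, and `β` takes that image back
    -- to `qₐ`, which moves `i` off `q`.
    linked : ∃[ j ] I.Linked q i j
    linked = j , ((a , a≢) , line) , ((_ , moved) , J.line-through moved-back)

-- Matching the factors.

-- Two states on opposite sides of `p` encode the two answers to the only question of `D`.
single-question⇒≤ : ∀ D E (q : Fin (nP D)) → (∀ a → a ≡ q) → TwoBlocks (part D q) →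
  ∀ p → TwoBlocks (part E p) → D ≤ᴬ E
single-question⇒≤ D E q only (_ , _ , _ , cover) p (y , y′ , y≁y′ , _) =
  (λ s → side (cover s)) , (λ _ → p) , λ a s t eq →
    subst (λ b → part D b s ≡ part D b t) (sym (only a)) (side-reflects (cover s) (cover t) eq)
  where
  side : ∀ {P Q : Set} → P ⊎ Q → Fin (nS E)
  side (inj₁ _) = y
  side (inj₂ _) = y′
  side-reflects : ∀ {s t u v} (c : part D q s ≡ u ⊎ part D q s ≡ v) (d : part D q t ≡ u ⊎ part D q t ≡ v) →
    part E p (side c) ≡ part E p (side d) → part D q s ≡ part D q t
  side-reflects (inj₁ c) (inj₁ d) _  = trans c (sym d)
  side-reflects (inj₂ c) (inj₂ d) _  = trans c (sym d)
  side-reflects (inj₁ _) (inj₂ _) eq = contradiction eq y≁y′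
  side-reflects (inj₂ _) (inj₁ _) eq = contradiction (sym eq) y≁y′

module Matching {n : ℕ} {Ds Es : Fin n → ASD} {A B : ASD}
  (X : Factorization Ds A) (Y : Factorization Es B)
  (φ : Fin (nS A) → Fin (nS B)) (α : Fin (nP A) → Fin (nP B))
  (refines : ∀ q → (part B (α q) ∘ φ) ⪯ part A q)
  (ψ : Fin (nS B) → Fin (nS A)) (β : Fin (nP B) → Fin (nP A))
  (refines′ : ∀ p → (part A (β p) ∘ ψ) ⪯ part B p)
  (βα : ∀ q → β (α q) ≡ q) (q : Fin (nP A))
  where
  private
    module X = Factorization X
    module Y = Factorization Y
    module I = InversePair X Y φ α refines ψ β refines′ βα
    p : Fin (nP B)
    p = α q
    module L = Links X Y φ α refines ψ β refines′ βα q
    module R = Links Y X ψ β refines′ φ α refines I.αβ p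

    Linked = I.Linked q

    -- Having a partner amounts to being movable.
    linked? : ∀ i → Dec (∃[ j ] Linked i j)
    linked? i with X.movable? q i
    ... | yes (_ , a≢) = yes (L.linked a≢)
    ... | no unmovable = no λ (_ , (movable , _) , _) → unmovable movable

    -- With the sides swapped the link is based at `β p`, which is `q`.
    linked-to : ∀ {j} → Y.Movable p j → ∃[ i ] Linked i j
    linked-to {j} (_ , b≢) =
      let i , (movable , line) , (movable′ , line′) = R.linked b≢ in
      i , (subst (λ z → X.Movable z i) (βα q) movable′ ,
           subst (λ z → I.F.MapsLine z i j) (βα q) line′) ,
          (movable , line)

    factors-≡ : ∀ {i j} → Linked i j → Ds i ≡ᴬ Es j
    factors-≡ ((movable , line) , (movable′ , line′)) =
      I.F.line⇒factor-≤ movable line , I.G.line⇒factor-≤ movable′ line′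

    extension : Σ[ γ ∈ Permutation′ n ] (∀ {i j} → Linked i j → Inverse.to γ i ≡ j)
    extension = extend-to-permutation Linked linked?
      (λ ((movable , line) , _) ((_ , line′) , _) → I.F.line-unique movable line line′)
      (λ (_ , (movable , line)) (_ , (_ , line′)) → I.G.line-unique movable line line′)

    γ : Permutation′ n
    γ = proj₁ extension

    -- A second question of the factor at `j` would link `j` to some `i′`; then `γ` sends both `i′`
    -- and `i` to `j`, so `i` would be linked after all.
    unlinked-≡ : ∀ i → ¬ (∃[ j ] Linked i j) → Ds i ≡ᴬ Es (Inverse.to γ i)
    unlinked-≡ i ¬linked =
      single-question⇒≤ (Ds i) (Es j) (X.Q.proj q i) only (X.binary i _) (Y.Q.proj p j) (Y.binary j _) ,
      single-question⇒≤ (Es j) (Ds i) (Y.Q.proj p j) only′ (Y.binary j _) (X.Q.proj q i) (X.binary i _)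
      where
      j : Fin n
      j = Inverse.to γ i
      only : ∀ a → a ≡ X.Q.proj q i
      only a = decidable-stable (a ≟ _) λ a≢ → ¬linked (L.linked a≢)
      only′ : ∀ b → b ≡ Y.Q.proj p j
      only′ b = decidable-stable (b ≟ _) λ b≢ →
        let i′ , link = linked-to (b , b≢) in
        ¬linked (j , subst (λ k → Linked k j) (Injection.injective (↔⇒↣ γ) (proj₂ extension link)) link)

  matching : Σ[ γ ∈ Permutation′ n ] (∀ i → Ds i ≡ᴬ Es (Inverse.to γ i))
  matching = γ , λ i → case i (linked? i)
    where
    case : ∀ i → Dec (∃[ j ] Linked i j) → Ds i ≡ᴬ Es (Inverse.to γ i)
    case i (yes (j , link)) = subst (λ k → Ds i ≡ᴬ Es k) (sym (proj₂ extension link)) (factors-≡ link)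
    case i (no ¬linked)     = unlinked-≡ i ¬linked

-- Running the round trip α, β until it returns to its start turns the two reductions into an inverse pair on questions.
equivalent⇒matching : ∀ {n} {Ds Es : Fin n → ASD} {A B} → Factorization Ds A → Factorization Es B →
  A ≡ᴬ B → Fin (nP A) → Σ[ γ ∈ Permutation′ n ] (∀ i → Ds i ≡ᴬ Es (Inverse.to γ i))
equivalent⇒matching {A = A} {B} X Y (r@(φ , α , refines) , r′@(ψ , β , refines′)) =
  -- `d` round trips and one more `α` precede the final `β`, so the composite is the full period
  -- `suc d`.
  Matching.matching X Y (φ ∘ φᵈ) (α ∘ αᵈ)
    (λ q x y eq → ≤ᴬ-power A round-trip d q x y (refines (αᵈ q) (φᵈ x) (φᵈ y) eq))
    ψ β refines′ (proj₂ period)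
  where
  round-trip : A ≤ᴬ A
  round-trip = ≤ᴬ-trans A B A r r′
  period : ∃[ d ] (∀ q → fold q (β ∘ α) (suc d) ≡ q)
  period = injective⇒periodic (Morphism.α-injective X Y φ α refines ∘ Morphism.α-injective Y X ψ β refines′)
  d : ℕ
  d = proj₁ period
  φᵈ : Fin (nS A) → Fin (nS A)
  φᵈ x = fold x (ψ ∘ φ) d
  αᵈ : Fin (nP A) → Fin (nP A)
  αᵈ q = fold q (β ∘ α) d

-- Passage to reduced factors, and uniqueness.

module ReducedFactors {m : ℕ} (Ds : Fin (suc m) → ASD)
  (binary : ∀ i → Binary (Ds i)) (nonempty : ∀ i → nP (Ds i) > 0)
  where
  private
    reduction : ∀ i → Σ[ D′ ∈ ASD ] (Ds i ≡ᴬ D′) × Binary D′ × Reduced D′ × Fin (nP D′)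
    reduction i = reduce (Ds i) (binary i) (fromℕ< (nonempty i))

  factors : Fin (suc m) → ASD
  factors i = proj₁ (reduction i)

  factor-≡ : ∀ i → Ds i ≡ᴬ factors i
  factor-≡ i = proj₁ (proj₂ (reduction i))

  factorization : Factorization factors (Prod m factors)
  factorization = record
    { coords = coordinates m factors
    ; binary = λ i → proj₁ (proj₂ (proj₂ (reduction i)))
    ; reduced = λ i → proj₁ (proj₂ (proj₂ (proj₂ (reduction i))))
    }

  product-≡ : Prod m Ds ≡ᴬ Prod m factors
  product-≡ =
    coordinatewise-≤ (coordinates m Ds) (coordinates m factors) (proj₁ ∘ factor-≡) ,
    coordinatewise-≤ (coordinates m factors) (coordinates m Ds) (proj₂ ∘ factor-≡)

  -- A base point for counting blocks and drawing lines.
  question : Fin (nP (Prod m factors))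
  question = Factorization.Q.tuple factorization (λ i → proj₂ (proj₂ (proj₂ (proj₂ (reduction i)))))

factor-count-≤ : ∀ {m n} {Ds : Fin m → ASD} {Es : Fin n → ASD} {A B} →
  Factorization Ds A → Factorization Es B → A ≤ᴬ B → Fin (nP A) → m ≤ n
factor-count-≤ {A = A} {B} X Y r q = ℕ.≮⇒≥ λ n<m →
  ℕ.<⇒≱ (ℕ.^-monoʳ-< 2 (ℕ.n<1+n 1) n<m)
    (classes-≤ {A} {B} r q (Factorization.classes X) (Factorization.classes Y))

factorization-unique : ∀ {m n} {Ds : Fin m → ASD} {Es : Fin n → ASD} {A B} →
  Factorization Ds A → Factorization Es B → A ≡ᴬ B → Fin (nP A) → Fin (nP B) →
  (m ≡ n) × (Σ[ γ ∈ Fin m ↔ Fin n ] (∀ i → Ds i ≡ᴬ Es (Inverse.to γ i)))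
factorization-unique X Y A≡B@(r , r′) q p
  with ℕ.≤-antisym (factor-count-≤ X Y r q) (factor-count-≤ Y X r′ p)
-- Exactness rests on equal block counts, so the matching comes only after the numbers of factors
-- are identified.
... | refl = refl , equivalent⇒matching X Y A≡B q

theorem3 : (D : ASD) (m n : ℕ)
    → (Ds : Fin (suc m) → ASD) → (Es : Fin (suc n) → ASD)
    → ((i : Fin (suc m)) → Binary (Ds i)) → ((j : Fin (suc n)) → Binary (Es j))
    → ((i : Fin (suc m)) → nP (Ds i) > 0) → ((j : Fin (suc n)) → nP (Es j) > 0)
    → D ≡ᴬ Prod m Ds → D ≡ᴬ Prod n Es
    → (m ≡ n) × (Σ[ γ ∈ Fin (suc m) ↔ Fin (suc n) ]
    ((i : Fin (suc m)) → Ds i ≡ᴬ Es (Inverse.to γ i)))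
theorem3 D m n Ds Es binD binE nonemptyD nonemptyE (D≤ , ≤D) D≡ =
  let m≡n , γ , matched = factorization-unique X.factorization Y.factorization A≡B X.question Y.question in
  -- Each given factor is equivalent to its reduced form, so the matching of reduced factors
  -- transfers.
  ℕ.suc-injective m≡n , γ , λ i →
    ≡ᴬ-trans (Ds i) (X.factors i) (Es (Inverse.to γ i)) (X.factor-≡ i)
      (≡ᴬ-trans (X.factors i) (Y.factors (Inverse.to γ i)) (Es (Inverse.to γ i))
        (matched i) (swap (Y.factor-≡ (Inverse.to γ i))))
  where
  module X = ReducedFactors Ds binD nonemptyD
  module Y = ReducedFactors Es binE nonemptyE
  A = Prod m X.factors
  B = Prod n Y.factors
  A≡B : A ≡ᴬ B
  A≡B = ≡ᴬ-trans A (Prod m Ds) B (swap X.product-≡)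
    (≡ᴬ-trans (Prod m Ds) D B (≤D , D≤) (≡ᴬ-trans D (Prod n Es) B D≡ Y.product-≡))
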